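{- 1) No infinite circulant graph with $2$ distances has a perfect $2$-colouring with parameters $(4,3)$. 2) No infinite circulant graph with $3$ distances has a perfect $2$-colouring with parameters $(5,3)$, $(5,4)$, $(6,4)$ or $(6,5)$. 3) No infinite circulant graph with $4$ distances has a perfect $2$-colouring with parameters $(6,5)$, $(7,4)$, $(8,3)$, $(7,5)$, $(7,6)$, $(8,5)$, $(8,6)$ or $(8,7)$.
   Context: Graphs may have loops and multiple edges. An infinite circulant graph with $k$ distances is a graph $C_\infty(l_1,\dots,l_k)$, where $l_1,\dots,l_k$ are nonnegative integers (not required to be distinct or nonzero), with vertex set $\mathbb{Z}$, in which numbers differing by $l_i$, for some $i$, are joined by an edge; it is $2k$-regular, the neighbours of a vertex $g$, counted with multiplicity, being $g+l_i$ and $g-l_i$ for $i=1,\dots,k$. A perfect $2$-colouring with parameters $(b,c)$ of a regular graph is a colouring of its vertices in two colours (black and white) such that each black vertex has exactly $b$ white neighbours and each white vertex has exactly $c$ black neighbours (neighbours counted with multiplicity). -}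

module Defs where

open import Data.Integer.Base using (ℤ; +_; _+_; _-_)
open import Data.Integer.Properties
  using (_≟_; +-assoc; +-inverseˡ; +-inverseʳ; +-identityʳ)
open import Data.Nat.Base as ℕ using (ℕ; suc)
import Data.Nat.Properties as ℕ
open import Data.Product.Base using (_×_; _,_; ∃)
open import Data.Vec.Base using (Vec; []; _∷_; _++_; map; count)
open import Relation.Binary.Definitions using (DecidableEquality)
open import Relation.Binary.PropositionalEquality
open import Relation.Nullary using (yes; no; contradiction)
open import Relation.Unary using (Pred; Decidable)

-- A d-regular graph, possibly infinite, possibly with loops and multiple
-- edges, given by the list of neighbours of each vertex with multiplicity.
record RegularGraph (d : ℕ) : Set₁ where
  field
    Vertex     : Set
    _≟ᵛ_       : DecidableEquality Vertex
    neighbours : Vertex → Vec Vertex d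

  multiplicity : Vertex → Vertex → ℕ
  multiplicity u v = count (v ≟ᵛ_) (neighbours u)

  field
    symmetric : ∀ u v → multiplicity u v ≡ multiplicity v u

data Colour : Set where
  black white : Colour

_≟ᶜ_ : DecidableEquality Colour
black ≟ᶜ black = yes refl
black ≟ᶜ white = no λ ()
white ≟ᶜ black = no λ ()
white ≟ᶜ white = yes refl

module _ {d : ℕ} (G : RegularGraph d) where
  open RegularGraph G

  Colouring : Set
  Colouring = Vertex → Colour

  neighboursColoured : Colouring → Colour → Vertex → ℕ
  neighboursColoured f x v = count (λ u → f u ≟ᶜ x) (neighbours v)

  -- For b, c ≥ 1 both colours necessarily occur: in a monochromatic colouring
  -- no vertex has a neighbour of the other colour.
  IsPerfect : ℕ → ℕ → Colouring → Set
  IsPerfect b c f =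
    (∀ v → f v ≡ black → neighboursColoured f white v ≡ b) ×
    (∀ v → f v ≡ white → neighboursColoured f black v ≡ c)

HasPerfectColouring : ∀ {d} → RegularGraph d → ℕ × ℕ → Set
HasPerfectColouring G (b , c) = ∃ (IsPerfect G b c)

-- A zero distance contributes the vertex itself twice.
circulantNeighbours : ∀ {k} → Vec ℕ k → ℤ → Vec ℤ (k ℕ.+ k)
circulantNeighbours ls g = map (λ l → g + + l) ls ++ map (λ l → g - + l) ls

private
  count-++ : ∀ {p m n} {A : Set} {P : Pred A p} (P? : Decidable P)
             (xs : Vec A m) (ys : Vec A n) →
             count P? (xs ++ ys) ≡ count P? xs ℕ.+ count P? ys
  count-++ P? []       ys = refl
  count-++ P? (x ∷ xs) ys with P? x
  ... | yes _ = cong suc (count-++ P? xs ys)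
  ... | no  _ = count-++ P? xs ys

  i+j-j≡i : ∀ i j → (i + j) - j ≡ i
  i+j-j≡i i j =
    trans (+-assoc i j _) (trans (cong (_+_ i) (+-inverseʳ j)) (+-identityʳ i))

  i-j+j≡i : ∀ i j → (i - j) + j ≡ i
  i-j+j≡i i j =
    trans (+-assoc i _ j) (trans (cong (_+_ i) (+-inverseˡ j)) (+-identityʳ i))

  count-shift : ∀ {k} (ls : Vec ℕ k) g h →
                count (h ≟_) (map (λ l → g + + l) ls) ≡
                count (g ≟_) (map (λ l → h - + l) ls)
  count-shift []       g h = refl
  count-shift (l ∷ ls) g h with h ≟ g + + l | g ≟ h - + l
  ... | yes _ | yes _ = cong suc (count-shift ls g h)
  ... | no  _ | no  _ = count-shift ls g h
  ... | yes p | no ¬q =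
    contradiction (sym (trans (cong (_- + l) p) (i+j-j≡i g (+ l)))) ¬q
  ... | no ¬p | yes q =
    contradiction (sym (trans (cong (_+ + l) q) (i-j+j≡i h (+ l)))) ¬p

  circulant-symmetric : ∀ {k} (ls : Vec ℕ k) g h →
                        count (h ≟_) (circulantNeighbours ls g) ≡
                        count (g ≟_) (circulantNeighbours ls h)
  circulant-symmetric ls g h = begin
    count (h ≟_) (up g ++ down g)                  ≡⟨ count-++ (h ≟_) (up g) (down g) ⟩
    count (h ≟_) (up g) ℕ.+ count (h ≟_) (down g)  ≡⟨ cong₂ ℕ._+_ (count-shift ls g h) (sym (count-shift ls h g)) ⟩
    count (g ≟_) (down h) ℕ.+ count (g ≟_) (up h)  ≡⟨ ℕ.+-comm (count (g ≟_) (down h)) _ ⟩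
    count (g ≟_) (up h) ℕ.+ count (g ≟_) (down h)  ≡⟨ count-++ (g ≟_) (up h) (down h) ⟨
    count (g ≟_) (up h ++ down h)                  ∎
    where
    open ≡-Reasoning
    up down : ℤ → Vec ℤ _
    up   x = map (λ l → x + + l) ls
    down x = map (λ l → x - + l) ls

circulant : ∀ {k} → Vec ℕ k → RegularGraph (k ℕ.+ k)
circulant ls = record
  { Vertex     = ℤ
  ; _≟ᵛ_       = _≟_
  ; neighbours = circulantNeighbours ls
  ; symmetric  = circulant-symmetric ls
  }

{-# OPTIONS --safe #-}

-- Let h be b on black and −c on white vertices.  Perfection says that the sum
-- of h over the neighbours of g is (2k − b − c) h(g); adding b + c − 2k zero
-- shifts to the 2k shifts ±lᵢ gives a family S of b + c shifts with
-- Σ_{s ∈ S} h(g + s) = 0 for all g.  The q-th power of the operator Σ_{s ∈ S} Tˢ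
-- is Σ_{s ∈ S} T^{qs} modulo a prime q, so for q larger than all the sums
-- involved Σ_{s ∈ S} h(g + q s) = 0 as well, and likewise for every multiplier
-- without small prime factors.
--
-- A deterministic recurrence makes h periodic.  Let pʷ be a prime power dividing
-- b + c with p ∤ c.  Summing h over translates removes the prime-to-p part of
-- the period; the result has period pᵃ, is congruent mod pʷ to a constant prime
-- to p, and is annihilated by uS for every u prime to p.  Summing over these u
-- shows that if pⁿ⁺¹ is a period but pⁿ is not, then the number Z(n) of s ∈ S
-- divisible by pⁿ equals p Z(n + 1).  The congruence forces this to happen at
-- least w times, so pʷ (b + c − 2k) ≤ b + c, which fails in every listed case.

module Submission where

open import Defs
open import Data.Fin.Base as Fin using (Fin; zero; suc; toℕ)
import Data.Fin.Properties as Fin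
open import Data.Integer.Base hiding (suc; _⊔_; _^_)
open import Data.Integer.Divisibility.Signed as ℤ using (_∣_; divides)
open import Data.Integer.Properties
open import Data.Integer.Tactic.RingSolver using (solve-∀)
open import Data.List.Base using (List; []; _∷_)
open import Data.List.Relation.Unary.All using (All; []; _∷_)
open import Data.Nat.Base as ℕ using (ℕ; zero; suc; _!)
open import Data.Nat.Combinatorics using (_C_; nCk+nC[k+1]≡[n+1]C[k+1]; nCn≡1; k>n⇒nCk≡0; nCk≡n!/k![n-k]!; k![n∸k]!∣n!)
open import Data.Nat.Coprimality as ℕ using (Coprime; coprime?)
import Data.Nat.DivMod as ℕ
import Data.Nat.Divisibility as ℕ
import Data.Nat.GCD as ℕ
open import Data.Nat.Induction using (<-rec)
open import Data.Nat.ListAction using (product)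
open import Data.Nat.Primality as ℕ using (Prime; euclidsLemma)
open import Data.Nat.Primality.Factorisation using (PrimeFactorisation; factorise)
import Data.Nat.Properties as ℕ
open import Data.Product.Base using (_×_; _,_; ∃; ∃₂; proj₁; proj₂)
open import Data.Sum.Base using (_⊎_; inj₁; inj₂; [_,_]′)
open import Data.Vec.Base as Vec using (Vec; []; _∷_; _++_; lookup)
open import Data.Vec.Functional using (Vector; head; tail)
import Data.Vec.Properties as Vec
open import Function.Base using (_∘_)
open import Relation.Binary.PropositionalEquality
open import Relation.Nullary using (¬_; Dec; yes; no; contradiction)
open import Relation.Nullary.Decidable using (True; False; toWitness; toWitnessFalse)

open import Algebra.Properties.AbelianGroup +-0-abelianGroup using (∙-cancelˡ)
open import Algebra.Properties.CommutativeSemigroup +-commutativeSemigroup using (xy∙z≈xz∙y; x∙yz≈y∙xz)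
open import Algebra.Properties.Semiring.Sum +-*-semiring using (sum; sum-syntax; sum-cong-≗; sum-init-last; ∑-distrib-+; ∑-comm; sum-replicate-zero)

private
  variable
    d : ℕ

-- Finite sums of integers

sum-zero : ∀ {n} {f : Vector ℤ n} → (∀ i → f i ≡ 0ℤ) → sum f ≡ 0ℤ
sum-zero {n} f≗0 = trans (sum-cong-≗ f≗0) (sum-replicate-zero n)

sum-neg : ∀ {n} (f : Vector ℤ n) → sum (λ i → - f i) ≡ - sum f
sum-neg {zero}  f = refl
sum-neg {suc n} f = trans (cong (_+_ (- f zero)) (sum-neg (f ∘ suc))) (sym (neg-distrib-+ (f zero) (sum (f ∘ suc))))

∑< : ℕ → (ℕ → ℤ) → ℤ
∑< n f = ∑[ k < n ] f (toℕ k)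

∑<-cong : ∀ n {f h : ℕ → ℤ} → (∀ k → k ℕ.< n → f k ≡ h k) → ∑< n f ≡ ∑< n h
∑<-cong n f≗h = sum-cong-≗ λ k → f≗h (toℕ k) (Fin.toℕ<n k)

∑<-suc : ∀ n f → ∑< (suc n) f ≡ ∑< n f + f n
∑<-suc n f = trans (sum-init-last {n} (f ∘ toℕ))
  (cong₂ _+_ (sum-cong-≗ {n} λ k → cong f (Fin.toℕ-inject₁ k)) (cong f (Fin.toℕ-fromℕ n)))

∑<-+ : ∀ n f h → ∑< n (λ k → f k + h k) ≡ ∑< n f + ∑< n h
∑<-+ n f h = ∑-distrib-+ {n} (f ∘ toℕ) (h ∘ toℕ)

∣-∑< : ∀ n {i} {f : ℕ → ℤ} → (∀ k → k ℕ.< n → i ∣ f k) → i ∣ ∑< n f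
∣-∑< zero    i∣f = divides 0ℤ refl
∣-∑< (suc n) i∣f = ℤ.∣m∣n⇒∣m+n (i∣f 0 ℕ.z<s) (∣-∑< n λ k k<n → i∣f (suc k) (ℕ.s<s k<n))

-- Binomial coefficients modulo a prime

prime∤! : ∀ {q} → Prime q → ∀ {k} → k ℕ.< q → ¬ q ℕ.∣ k !
prime∤! pq {zero}  _   q∣1 = contradiction (ℕ.∣1⇒≡1 q∣1) λ { refl → ℕ.¬prime[1] pq }
prime∤! pq {suc k} k<q q∣k! with euclidsLemma (suc k) (k !) pq q∣k!
... | inj₁ q∣1+k = contradiction (ℕ.∣⇒≤ q∣1+k) (ℕ.<⇒≱ k<q)
... | inj₂ q∣k!′ = prime∤! pq (ℕ.<-trans (ℕ.n<1+n k) k<q) q∣k!′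

n∣n! : ∀ n → .{{ℕ.NonZero n}} → n ℕ.∣ n !
n∣n! (suc n) = ℕ.m∣m*n (n !)

-- The prime `q` divides `q !`, which is the product of `q C k` with `k !` and `(q ∸ k) !`. Both
-- factorials have only factors below `q`, so by Euclid's lemma `q` must divide the coefficient.
prime∣C : ∀ {q} → Prime q → ∀ {k} → 0 ℕ.< k → k ℕ.< q → q ℕ.∣ q C k
prime∣C {q} pq {k} 0<k k<q
  with euclidsLemma (q C k) (k ! ℕ.* (q ℕ.∸ k) !) pq
         (subst (q ℕ.∣_) (sym C*k![q∸k]!≡q!) (n∣n! q {{ℕ.prime⇒nonZero pq}}))
  where
  C*k![q∸k]!≡q! : (q C k) ℕ.* (k ! ℕ.* (q ℕ.∸ k) !) ≡ q !
  C*k![q∸k]!≡q! = trans (cong (ℕ._* (k ! ℕ.* (q ℕ.∸ k) !)) (nCk≡n!/k![n-k]! (ℕ.<⇒≤ k<q)))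
    (ℕ.m/n*n≡m {n = k ! ℕ.* (q ℕ.∸ k) !} {{k ℕ.!* (q ℕ.∸ k) !≢0}} (k![n∸k]!∣n! (ℕ.<⇒≤ k<q)))
... | inj₁ q∣C = q∣C
... | inj₂ q∣k![q∸k]! with euclidsLemma (k !) ((q ℕ.∸ k) !) pq q∣k![q∸k]!
...   | inj₁ q∣k! = contradiction q∣k! (prime∤! pq k<q)
...   | inj₂ q∣[q∸k]! = contradiction q∣[q∸k]! (prime∤! pq (ℕ.∸-monoʳ-< 0<k (ℕ.<⇒≤ k<q)))

-- Shift operators and their prime powers

infixr 5 _⋆_

_⋆_ : Vector ℤ d → (ℤ → ℤ) → ℤ → ℤ
_⋆_ {d} s f g = ∑[ i < d ] f (g + s i)

Annihilates : Vector ℤ d → (ℤ → ℤ) → Set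
Annihilates s f = ∀ g → (s ⋆ f) g ≡ 0ℤ

power : Vector ℤ d → ℕ → (ℤ → ℤ) → ℤ → ℤ
power s zero    f = f
power s (suc n) f = s ⋆ power s n f

-- expand n Φ is (x + y)ⁿ with each monomial xⁱyʲ replaced by Φ i j.
expand : ℕ → (ℕ → ℕ → ℤ) → ℤ
expand zero    Φ = Φ 0 0
expand (suc n) Φ = expand n (λ i j → Φ (suc i) j) + expand n (λ i j → Φ i (suc j))

expand-cong : ∀ n {Φ Ψ} → (∀ i j → Φ i j ≡ Ψ i j) → expand n Φ ≡ expand n Ψ
expand-cong zero    eq = eq 0 0
expand-cong (suc n) eq = cong₂ _+_ (expand-cong n λ i j → eq (suc i) j) (expand-cong n λ i j → eq i (suc j))

expand-sum : ∀ n (Φ : Fin d → ℕ → ℕ → ℤ) →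
             ∑[ k < d ] expand n (Φ k) ≡ expand n (λ i j → ∑[ k < d ] Φ k i j)
expand-sum zero    Φ = refl
expand-sum (suc n) Φ = trans (∑-distrib-+ (λ k → expand n (λ i j → Φ k (suc i) j)) _)
  (cong₂ _+_ (expand-sum n λ k i j → Φ k (suc i) j) (expand-sum n λ k i j → Φ k i (suc j)))

expand-binomial : ∀ n Φ → expand n Φ ≡ ∑< (suc n) (λ k → + (n C k) * Φ k (n ℕ.∸ k))
expand-binomial zero    Φ = sym (trans (+-identityʳ _) (*-identityˡ _))
expand-binomial (suc n) Φ = begin
  expand n (λ i j → Φ (suc i) j) + expand n (λ i j → Φ i (suc j))
    ≡⟨ cong₂ _+_ (expand-binomial n _) (expand-binomial n _) ⟩
  ∑< (suc n) up + ∑< (suc n) (λ k → + (n C k) * Φ k (suc (n ℕ.∸ k)))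
    ≡⟨ cong (_+_ (∑< (suc n) up)) (begin
         ∑< (suc n) (λ k → + (n C k) * Φ k (suc (n ℕ.∸ k)))
           ≡⟨ ∑<-cong (suc n) (λ k k<1+n → cong (λ j → + (n C k) * Φ k j) (sym (ℕ.+-∸-assoc 1 (ℕ.s≤s⁻¹ k<1+n)))) ⟩
         ∑< (suc n) t
           ≡⟨ +-identityʳ (∑< (suc n) t) ⟨
         ∑< (suc n) t + 0ℤ
           -- The term added at `suc n` is zero because n C (n + 1) = 0. It extends the range so
           -- that `t 0` can be split off and the rest aligned with `up` for Pascal's rule.
           ≡⟨ cong (λ c → ∑< (suc n) t + + c * Φ (suc n) (n ℕ.∸ n)) (k>n⇒nCk≡0 (ℕ.n<1+n n)) ⟨
         ∑< (suc n) t + t (suc n)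
           ≡⟨ ∑<-suc (suc n) t ⟨
         ∑< (suc (suc n)) t ∎) ⟩
  ∑< (suc n) up + (t 0 + ∑< (suc n) (t ∘ suc))
    ≡⟨ x∙yz≈y∙xz (∑< (suc n) up) (t 0) (∑< (suc n) (t ∘ suc)) ⟩
  t 0 + (∑< (suc n) up + ∑< (suc n) (t ∘ suc))
    ≡⟨ cong (_+_ (t 0)) (∑<-+ (suc n) up (t ∘ suc)) ⟨
  t 0 + ∑< (suc n) (λ k → up k + t (suc k))
    ≡⟨ cong (_+_ (t 0)) (∑<-cong (suc n) λ k _ → trans
         (sym (*-distribʳ-+ (Φ (suc k) (n ℕ.∸ k)) (+ (n C k)) (+ (n C suc k))))
         (cong (λ c → + c * Φ (suc k) (n ℕ.∸ k)) (nCk+nC[k+1]≡[n+1]C[k+1] n k))) ⟩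
  ∑< (suc (suc n)) (λ k → + (suc n C k) * Φ k (suc n ℕ.∸ k)) ∎
  where
  open ≡-Reasoning
  up t : ℕ → ℤ
  up k = + (n C k) * Φ (suc k) (n ℕ.∸ k)
  t k = + (n C k) * Φ k (suc n ℕ.∸ k)

-- All binomial coefficients strictly between the two ends are divisible by `q`, so only the pure
-- powers survive.
expand-prime : ∀ {q} → Prime q → ∀ Φ → + q ∣ expand q Φ - (Φ 0 q + Φ q 0)
expand-prime {zero} ()
expand-prime {suc q} pq Φ = subst (+ suc q ∣_) (sym eq) (∣-∑< q λ k k<q →
  ℤ.∣m⇒∣m*n {m = + (suc q C suc k)} (Φ (suc k) (q ℕ.∸ k)) (ℤ.∣ᵤ⇒∣ (prime∣C pq (ℕ.s≤s ℕ.z≤n) (ℕ.s≤s k<q))))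
  where
  t : ℕ → ℤ
  t k = + (suc q C k) * Φ k (suc q ℕ.∸ k)
  mid ends : ℤ
  mid = ∑< q (t ∘ suc)
  ends = Φ 0 (suc q) + Φ (suc q) 0
  last : t (suc q) ≡ Φ (suc q) 0
  last = trans (cong₂ (λ c j → + c * Φ (suc q) j) (nCn≡1 (suc q)) (ℕ.n∸n≡0 q)) (*-identityˡ (Φ (suc q) 0))
  cancel : ∀ a b c → (a + (b + c)) - (a + c) ≡ b
  cancel = solve-∀
  eq : expand (suc q) Φ - ends ≡ mid
  eq = begin
    expand (suc q) Φ - ends         ≡⟨ cong (_- ends) (expand-binomial (suc q) Φ) ⟩
    (t 0 + ∑< (suc q) (t ∘ suc)) - ends
      ≡⟨ cong (λ x → (t 0 + x) - ends) (∑<-suc q (t ∘ suc)) ⟩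
    (t 0 + (mid + t (suc q))) - ends
      ≡⟨ cong₂ (λ x y → (x + (mid + y)) - ends) (*-identityˡ (Φ 0 (suc q))) last ⟩
    (Φ 0 (suc q) + (mid + Φ (suc q) 0)) - ends ≡⟨ cancel (Φ 0 (suc q)) mid (Φ (suc q) 0) ⟩
    mid ∎
    where open ≡-Reasoning

-- The shift by `head s` commutes with the operator of `tail s`, so the power of their sum expands
-- binomially: `i` counts the uses of the head and `j` those of the tail.
power-expand : ∀ n (s : Vector ℤ (suc d)) f g →
               power s n f g ≡ expand n (λ i j → power (tail s) j f (g + + i * head s))
power-expand zero    s f g = cong f (sym (+-identityʳ g))
power-expand (suc n) s f g = cong₂ _+_
  (trans (power-expand n s f (g + head s)) (expand-cong n λ i j → cong (power (tail s) j f) (assoc g (head s) (+ i))))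
  (trans (sum-cong-≗ λ k → power-expand n s f (g + tail s k))
  (trans (expand-sum n λ k i j → power (tail s) j f (g + tail s k + + i * head s))
  (expand-cong n λ i j → sum-cong-≗ λ k → cong (power (tail s) j f) (xy∙z≈xz∙y g (tail s k) (+ i * head s)))))
  where
  assoc : ∀ g x i → g + x + i * x ≡ g + (1ℤ + i) * x
  assoc = solve-∀

scale : ℤ → Vector ℤ d → Vector ℤ d
scale u s i = u * s i

-- Induction on the number of shifts. Modulo `q` the power splits into the q-th power of the head
-- shift, which is the shift by `q * head s`, and the q-th power of the tail operator, to which the
-- induction hypothesis applies.
frobenius : ∀ {q} → Prime q → ∀ {d} (s : Vector ℤ d) f g → + q ∣ power s q f g - (scale (+ q) s ⋆ f) g
frobenius {zero}  ()
frobenius {suc q} pq {zero}  s f g = divides 0ℤ refl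
frobenius {q} pq {suc d} s f g = subst (+ q ∣_) eq
  (ℤ.∣m∣n⇒∣m+n (expand-prime pq (λ i j → power (tail s) j f (g + + i * head s))) (frobenius pq (tail s) f g))
  where
  cancel : ∀ e a b c → (e - (a + b)) + (a - c) ≡ e - (b + c)
  cancel = solve-∀
  eq : _ ≡ power s q f g - (scale (+ q) s ⋆ f) g
  eq = trans (cong₂ (λ e a → (e - (a + f (g + + q * head s))) + (power (tail s) q f g - (scale (+ q) (tail s) ⋆ f) g))
                (sym (power-expand q s f g)) (cong (power (tail s) q f) (+-identityʳ g)))
             (cancel (power s q f g) (power (tail s) q f g) _ _)

power-annihilates : ∀ n (s : Vector ℤ d) {f} → Annihilates s f → ∀ g → power s (suc n) f g ≡ 0ℤ
power-annihilates zero    s ann = ann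
power-annihilates (suc n) s ann g = sum-zero λ i → power-annihilates n s ann (g + s i)

prime∣scale⋆ : ∀ {q} → Prime q → (s : Vector ℤ d) → ∀ {f} → Annihilates s f → ∀ g → + q ∣ (scale (+ q) s ⋆ f) g
prime∣scale⋆ {q = zero}  ()
prime∣scale⋆ {q = suc q} pq s {f} ann g =
  subst (+ suc q ∣_) (trans (cong (λ x → - (x - y)) (power-annihilates q s ann g)) (negate y)) (ℤ.∣m⇒∣-m (frobenius pq s f g))
  where
  y = (scale (+ suc q) s ⋆ f) g
  negate : ∀ y → - (0ℤ - y) ≡ y
  negate = solve-∀

-- Multipliers without small prime factors

Bounded : ℕ → (ℤ → ℤ) → Set
Bounded B f = ∀ g → ∣ f g ∣ ℕ.≤ B

Period : (ℤ → ℤ) → ℤ → Set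
Period f P = ∀ g → f (g + P) ≡ f g

annihilates-difference : ∀ {f} (s : Vector ℤ d) P → Annihilates s f → Annihilates s (λ g → f g - f (g + P))
annihilates-difference {d} {f} s P ann g = trans (∑-distrib-+ {d} (λ i → f (g + s i)) (λ i → - f (g + s i + P)))
  (cong₂ _+_ (ann g) (trans (sum-neg {d} (λ i → f (g + s i + P)))
    (cong -_ (trans (sum-cong-≗ {d} λ i → cong f (xy∙z≈xz∙y g (s i) P)) (ann (g + P))))))

∣sum∣≤ : ∀ {n B} {f : Vector ℤ n} → (∀ i → ∣ f i ∣ ℕ.≤ B) → ∣ sum f ∣ ℕ.≤ n ℕ.* B
∣sum∣≤ {zero}      f≤B = ℕ.z≤n
∣sum∣≤ {suc n} {f = f} f≤B = ℕ.≤-trans (∣i+j∣≤∣i∣+∣j∣ (f zero) (sum (f ∘ suc))) (ℕ.+-mono-≤ (f≤B zero) (∣sum∣≤ (f≤B ∘ suc)))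

∣∧<⇒≡0 : ∀ {k i} → k ∣ i → ∣ i ∣ ℕ.< ∣ k ∣ → i ≡ 0ℤ
∣∧<⇒≡0 {i = + zero}    k∣i i<k = refl
∣∧<⇒≡0 {i = +[1+ _ ]}  k∣i i<k = contradiction (ℕ.∣⇒≤ (ℤ.∣⇒∣ᵤ k∣i)) (ℕ.<⇒≱ i<k)
∣∧<⇒≡0 {i = -[1+ _ ]}  k∣i i<k = contradiction (ℕ.∣⇒≤ (ℤ.∣⇒∣ᵤ k∣i)) (ℕ.<⇒≱ i<k)

⋆-cong : ∀ {s t : Vector ℤ d} f → (∀ i → s i ≡ t i) → ∀ g → (s ⋆ f) g ≡ (t ⋆ f) g
⋆-cong f s≗t g = sum-cong-≗ λ i → cong (λ x → f (g + x)) (s≗t i)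

module _ {B} {f : ℤ → ℤ} (f≤B : Bounded B f) where

  -- The scaled sum is a multiple of `q` by Frobenius, but its absolute value is at most `d * B`,
  -- which is below `q`.
  annihilates-prime : ∀ {q} → Prime q → (s : Vector ℤ d) → d ℕ.* B ℕ.< q →
                      Annihilates s f → Annihilates (scale (+ q) s) f
  annihilates-prime {d = d} {q = q} pq s dB<q ann g =
    ∣∧<⇒≡0 (prime∣scale⋆ pq s {f} ann g) (ℕ.≤-<-trans (∣sum∣≤ {d} λ i → f≤B (g + scale (+ q) s i)) dB<q)

  -- Scaling changes neither the number of shifts nor the bound on `f`, so the same threshold
  -- `d * B` serves for each prime factor in turn.
  annihilates-product : ∀ {qs} → All Prime qs → (s : Vector ℤ d) →
    (∀ {q} → Prime q → q ℕ.∣ product qs → d ℕ.* B ℕ.< q) →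
    Annihilates s f → Annihilates (scale (+ product qs) s) f
  annihilates-product []         s large ann g = trans (⋆-cong f (λ i → *-identityˡ (s i)) g) (ann g)
  annihilates-product {qs = q ∷ qs} (pq ∷ pqs) s large ann g =
    trans (⋆-cong f (λ i → trans (cong (_* s i) (pos-* q (product qs))) (*-assoc (+ q) (+ product qs) (s i))) g)
      (annihilates-prime pq (scale (+ product qs) s) (large pq (ℕ.m∣m*n (product qs)))
        (annihilates-product pqs s (λ pr r∣ → large pr (ℕ.∣n⇒∣m*n q r∣)) ann) g)

  annihilates-rough : ∀ j → .{{ℕ.NonZero j}} → (s : Vector ℤ d) →
    (∀ {q} → Prime q → q ℕ.∣ j → d ℕ.* B ℕ.< q) →
    Annihilates s f → Annihilates (scale (+ j) s) f
  annihilates-rough j s large ann = subst (λ x → Annihilates (scale (+ x) s) f) (sym isFactorisation)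
    (annihilates-product factorsPrime s (λ pq q∣ → large pq (subst (_ ℕ.∣_) (sym isFactorisation) q∣)) ann)
    where open PrimeFactorisation (factorise j)

-- Periods, and multipliers coprime to a period

prime∤⇒coprime : ∀ {q u} → Prime q → ¬ q ℕ.∣ u → Coprime q u
prime∤⇒coprime pq q∤u (i∣q , i∣u) with ℕ.prime⇒irreducible pq i∣q
... | inj₁ i≡1  = i≡1
... | inj₂ refl = contradiction i∣u q∤u

-- The witness is the product of those numbers up to `N` that are coprime to `u`. A prime up to `N`
-- not dividing `u` is itself one of the factors.
prime-split : ∀ N u → ∃ λ t →
  (∀ {q} → Prime q → q ℕ.∣ t → ¬ q ℕ.∣ u) ×
  (∀ {q} → Prime q → q ℕ.≤ N → ¬ q ℕ.∣ u → q ℕ.∣ t)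
prime-split zero u = 1 ,
  (λ pq q∣1 → contradiction (ℕ.∣1⇒≡1 q∣1) λ { refl → ℕ.¬prime[1] pq }) ,
  (λ { {zero} () ; {suc _} _ () })
prime-split (suc N) u with prime-split N u | coprime? (suc N) u
... | t , t-coprime , t-all | yes cop = suc N ℕ.* t ,
  (λ {q} pq q∣ q∣u → case-∣ pq q∣u (euclidsLemma (suc N) t pq q∣)) ,
  (λ pq q≤1+N q∤u → case-≤ pq q∤u (ℕ.m≤n⇒m<n∨m≡n q≤1+N))
  where
  case-∣ : ∀ {q} → Prime q → q ℕ.∣ u → q ℕ.∣ suc N ⊎ q ℕ.∣ t → _
  case-∣ pq q∣u (inj₁ q∣N) = contradiction (cop (q∣N , q∣u)) λ { refl → ℕ.¬prime[1] pq }
  case-∣ pq q∣u (inj₂ q∣t) = t-coprime pq q∣t q∣u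
  case-≤ : ∀ {q} → Prime q → ¬ q ℕ.∣ u → q ℕ.< suc N ⊎ q ≡ suc N → q ℕ.∣ suc N ℕ.* t
  case-≤ pq q∤u (inj₁ q<1+N) = ℕ.∣n⇒∣m*n (suc N) (t-all pq (ℕ.s≤s⁻¹ q<1+N) q∤u)
  case-≤ pq q∤u (inj₂ refl)  = ℕ.m∣m*n t
... | t , t-coprime , t-all | no ¬cop = t , t-coprime ,
  (λ pq q≤1+N q∤u → case-≤ pq q∤u (ℕ.m≤n⇒m<n∨m≡n q≤1+N))
  where
  case-≤ : ∀ {q} → Prime q → ¬ q ℕ.∣ u → q ℕ.< suc N ⊎ q ≡ suc N → q ℕ.∣ t
  case-≤ pq q∤u (inj₁ q<1+N) = t-all pq (ℕ.s≤s⁻¹ q<1+N) q∤u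
  case-≤ pq q∤u (inj₂ refl)  = contradiction (λ {_} → prime∤⇒coprime pq q∤u) ¬cop

period-multiple : ∀ {f P} → Period f P → ∀ n → Period f (+ n * P)
period-multiple {f} {P} per zero    g = cong f (trans (cong (_+_ g) (*-zeroˡ P)) (+-identityʳ g))
period-multiple {f} {P} per (suc n) g = trans (cong f (assoc g (+ n) P)) (trans (per _) (period-multiple per n g))
  where
  assoc : ∀ g n P → g + (1ℤ + n) * P ≡ g + n * P + P
  assoc = solve-∀

period-neg : ∀ {f P} → Period f P → Period f (- P)
period-neg {f} {P} per g = trans (sym (per (g - P))) (cong f (cancel g P))
  where
  cancel : ∀ g P → g - P + P ≡ g
  cancel = solve-∀

period-∣ : ∀ {f P Q} → Period f P → P ∣ Q → Period f Q
period-∣ {f} {P} per (divides (+ n) refl) = period-multiple per n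
period-∣ {f} {P} per (divides -[1+ n ] refl) =
  subst (Period f) (neg-distribˡ-* (+ suc n) P) (period-neg (period-multiple per (suc n)))

-- Modulo the period P, u is congruent to u + P t, where t is the product of
-- small numbers prime to u, and u + P t has no small prime factor.
annihilates-coprime : ∀ {B f P} → Bounded B f → Period f (+ P) → (s : Vector ℤ d) → Annihilates s f →
  ∀ u → .{{ℕ.NonZero u}} → Coprime u P → Annihilates (scale (+ u) s) f
annihilates-coprime {d} {B} {f} {P} f≤B per s ann u cop
  with prime-split (d ℕ.* B) u
... | t , t-coprime , t-all = λ g → trans (sum-cong-≗ {d} λ i → sym (trans
        (cong f (trans (cong (λ x → g + x * s i) (trans (pos-+ u (P ℕ.* t)) (cong (_+_ (+ u)) (pos-* P t)))) (expand-j g (+ u) (+ P) (+ t) (s i))))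
        (period-∣ {f} per (divides (+ t * s i) refl) (g + + u * s i))))
      (annihilates-rough {f = f} f≤B j {{ℕ.>-nonZero (ℕ.<-≤-trans (ℕ.>-nonZero⁻¹ u) (ℕ.m≤m+n u (P ℕ.* t)))}} s large ann g)
  where
  j = u ℕ.+ P ℕ.* t
  expand-j : ∀ g u P t x → g + (u + P * t) * x ≡ (g + u * x) + t * x * P
  expand-j = solve-∀
  -- A small prime dividing `j` but not `u` divides `t`, and therefore divides `u` after all. A
  -- prime dividing both `j` and `u` divides `P * t`, against the coprimality of `u` to `P` and to
  -- `t`.
  large : ∀ {q} → Prime q → q ℕ.∣ j → d ℕ.* B ℕ.< q
  large {q} pq q∣j = ℕ.≰⇒> λ q≤N → small q≤N (q ℕ.∣? u)
    where
    small : q ℕ.≤ d ℕ.* B → _ → _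
    small q≤N (no q∤u) = q∤u (ℕ.∣m+n∣m⇒∣n (subst (q ℕ.∣_) (ℕ.+-comm u _) q∣j) (ℕ.∣n⇒∣m*n P (t-all pq q≤N q∤u)))
    small q≤N (yes q∣u) with euclidsLemma P t pq (ℕ.∣m+n∣m⇒∣n q∣j q∣u)
    ... | inj₁ q∣P = contradiction (cop (q∣u , q∣P)) λ { refl → ℕ.¬prime[1] pq }
    ... | inj₂ q∣t = t-coprime pq q∣t q∣u

-- By Bézout the gcd is a multiple of one period minus a multiple of the other. Over the naturals
-- the identity comes in two orientations, hence the two cases.
period-gcd : ∀ {f x y} → Period f (+ x) → Period f (+ y) → Period f (+ ℕ.gcd x y)
period-gcd {f} {x} {y} perx pery g with ℕ.Bézout.identity (ℕ.gcd-GCD x y)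
... | ℕ.Bézout.+- a b eq = trans (sym (period-multiple pery b (g + + ℕ.gcd x y)))
        (trans (cong f (trans (+-assoc g _ _) (cong (_+_ g) (cast eq)))) (period-multiple perx a g))
  where
  cast : ∀ {k} → k ℕ.+ b ℕ.* y ≡ a ℕ.* x → + k + + b * + y ≡ + a * + x
  cast {k} e = trans (cong (_+_ (+ k)) (sym (pos-* b y))) (trans (cong +_ e) (pos-* a x))
... | ℕ.Bézout.-+ a b eq = trans (sym (period-multiple perx a (g + + ℕ.gcd x y)))
        (trans (cong f (trans (+-assoc g _ _) (cong (_+_ g) (cast eq)))) (period-multiple pery b g))
  where
  cast : ∀ {k} → k ℕ.+ a ℕ.* x ≡ b ℕ.* y → + k + + a * + x ≡ + b * + y
  cast {k} e = trans (cong (_+_ (+ k)) (sym (pos-* a x))) (trans (cong +_ e) (pos-* b y))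

∣prime^ : ∀ {p} → Prime p → ∀ n {y} → y ℕ.∣ p ℕ.^ n → y ≡ 1 ⊎ p ℕ.∣ y
∣prime^ pp zero    y∣1 = inj₁ (ℕ.∣1⇒≡1 y∣1)
∣prime^ {p} pp (suc n) {y} y∣p^[1+n] with p ℕ.∣? y
... | yes p∣y = inj₂ p∣y
... | no  p∤y = ∣prime^ pp n (ℕ.coprime-divisor (ℕ.sym (prime∤⇒coprime pp p∤y)) y∣p^[1+n])

-- The cofactor `y` also divides the prime power, so it is 1 or has a factor `p`, which cancels.
∣prime^suc : ∀ {p} → Prime p → ∀ n {x} → x ℕ.∣ p ℕ.^ suc n → x ≡ p ℕ.^ suc n ⊎ x ℕ.∣ p ℕ.^ n
∣prime^suc {p} pp n {x} (ℕ.divides y eq) with ∣prime^ pp (suc n) (ℕ.divides x (trans eq (ℕ.*-comm y x)))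
... | inj₁ refl = inj₁ (sym (trans eq (ℕ.*-identityˡ x)))
... | inj₂ (ℕ.divides z refl) = inj₂ (ℕ.divides z (ℕ.*-cancelˡ-≡ (p ℕ.^ n) (z ℕ.* x) p {{ℕ.prime⇒nonZero pp}}
        (trans eq (trans (cong (ℕ._* x) (ℕ.*-comm z p)) (ℕ.*-assoc p z x)))))

-- Orbit sums

orbitSum : ℕ → ℤ → (ℤ → ℤ) → ℤ → ℤ
orbitSum N e f g = ∑< N (λ t → f (g + + t * e))

-- Splitting off the first or the last of `suc N` translates gives the shifted or the original orbit
-- sum. The two split-off terms agree because `N * e` is a period.
orbitSum-step : ∀ {N e f} → Period f (+ N * e) → Period (orbitSum N e f) e
orbitSum-step {N} {e} {f} per g = ∙-cancelˡ (f g) _ _ (begin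
  f g + orbitSum N e f (g + e)
    ≡⟨ cong₂ _+_ (cong f (sym (trans (cong (_+_ g) (*-zeroˡ e)) (+-identityʳ g))))
                 (∑<-cong N λ t _ → cong f (assoc g e (+ t))) ⟩
  orbitSum (suc N) e f g
    ≡⟨ ∑<-suc N (λ t → f (g + + t * e)) ⟩
  orbitSum N e f g + f (g + + N * e)
    ≡⟨ trans (cong (_+_ (orbitSum N e f g)) (per g)) (+-comm (orbitSum N e f g) (f g)) ⟩
  f g + orbitSum N e f g ∎)
  where
  open ≡-Reasoning
  assoc : ∀ g e t → g + e + t * e ≡ g + (1ℤ + t) * e
  assoc = solve-∀

orbitSum-period : ∀ {N e f P} → Period f P → Period (orbitSum N e f) P
orbitSum-period {N} {e} {f} {P} per g = ∑<-cong N λ t _ → trans (cong f (xy∙z≈xz∙y g P (+ t * e))) (per (g + + t * e))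

orbitSum-annihilates : ∀ {N e f} (s : Vector ℤ d) → Annihilates s f → Annihilates s (orbitSum N e f)
orbitSum-annihilates {d} {N} {e} {f} s ann g = begin
  ∑[ i < d ] ∑[ t < N ] f (g + s i + + toℕ t * e)
    ≡⟨ ∑-comm {d} {N} (λ i t → f (g + s i + + toℕ t * e)) ⟩
  ∑[ t < N ] ∑[ i < d ] f (g + s i + + toℕ t * e)
    ≡⟨ sum-zero {N} (λ t → trans (sum-cong-≗ {d} λ i → cong f (xy∙z≈xz∙y g (s i) (+ toℕ t * e))) (ann (g + + toℕ t * e))) ⟩
  0ℤ ∎
  where
  open ≡-Reasoning

orbitSum-≡mod : ∀ {M r f} N e → (∀ g → M ∣ f g - r) → ∀ g → M ∣ orbitSum N e f g - + N * r
orbitSum-≡mod {M} {r} {f} N e f≡r g = go N λ t → f (g + + t * e) , f≡r (g + + t * e)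
  where
  distrib : ∀ r x y n → (x - r) + (y - n * r) ≡ (x + y) - (1ℤ + n) * r
  distrib = solve-∀
  go : ∀ N (h : ℕ → ∃ λ x → M ∣ x - r) → M ∣ ∑< N (proj₁ ∘ h) - + N * r
  go zero    h = subst (M ∣_) (sym (cong -_ (*-zeroˡ r))) (divides 0ℤ refl)
  go (suc N) h = subst (M ∣_) (distrib r (proj₁ (h 0)) (∑< N (proj₁ ∘ h ∘ suc)) (+ N)) (ℤ.∣m∣n⇒∣m+n (proj₂ (h 0)) (go N (h ∘ suc)))

sum-const : ∀ n x → ∑[ i < n ] x ≡ + n * x
sum-const zero    x = sym (*-zeroˡ x)
sum-const (suc n) x = trans (cong (_+_ x) (sum-const n x)) (distrib x (+ n))
  where
  distrib : ∀ x n → x + n * x ≡ (1ℤ + n) * x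
  distrib = solve-∀

-- The range is cut into `q` blocks of length `p`; in each block only the first index is a multiple
-- of `p`.
∑<-multiples : ∀ p .{{_ : ℕ.NonZero p}} q {E : ℕ → ℤ} → (∀ u → ¬ p ℕ.∣ u → E u ≡ 0ℤ) →
               ∑< (q ℕ.* p) E ≡ ∑< q (λ t → E (t ℕ.* p))
∑<-multiples p zero E≡0 = refl
∑<-multiples (suc p) (suc q) {E} E≡0 = begin
  ∑< (suc p ℕ.+ q ℕ.* suc p) E
    ≡⟨ ∑<-append (suc p) (q ℕ.* suc p) E ⟩
  E 0 + ∑< p (E ∘ suc) + ∑< (q ℕ.* suc p) (λ u → E (suc p ℕ.+ u))
    ≡⟨ cong₂ _+_ (trans (cong (_+_ (E 0)) (sum-zero {p} λ k → E≡0 _ (∤k k))) (+-identityʳ (E 0)))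
         (∑<-multiples (suc p) q λ u p∤u → E≡0 _ (λ p∣p+u → p∤u (ℕ.∣m+n∣m⇒∣n p∣p+u ℕ.∣-refl))) ⟩
  E 0 + ∑< q (λ t → E (suc p ℕ.+ t ℕ.* suc p)) ∎
  where
  open ≡-Reasoning
  ∤k : ∀ (k : Fin p) → ¬ suc p ℕ.∣ suc (toℕ k)
  ∤k k p∣k = ℕ.<⇒≱ (ℕ.s<s (Fin.toℕ<n k)) (ℕ.∣⇒≤ p∣k)
  ∑<-append : ∀ m n f → ∑< (m ℕ.+ n) f ≡ ∑< m f + ∑< n (λ k → f (m ℕ.+ k))
  ∑<-append zero    n f = sym (+-identityˡ _)
  ∑<-append (suc m) n f = trans (cong (_+_ (f 0)) (∑<-append m n (f ∘ suc))) (sym (+-assoc (f 0) _ _))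

-- Counting the shifts divisible by a number

indicator : ∀ {A : Set} → Dec A → ℕ
indicator (yes _) = 1
indicator (no _)  = 0

-- For `P = 0` this counts the zero shifts, since 0 divides only itself.
multiples : ℕ → Vector ℤ d → ℕ
multiples {zero}  P s = 0
multiples {suc d} P s = indicator (+ P ℤ.∣? s zero) ℕ.+ multiples P (s ∘ suc)

multiples≤ : ∀ P (s : Vector ℤ d) → multiples P s ℕ.≤ d
multiples≤ {zero}  P s = ℕ.z≤n
multiples≤ {suc d} P s = ℕ.+-mono-≤ (indicator≤1 (+ P ℤ.∣? s zero)) (multiples≤ P (s ∘ suc))
  where
  indicator≤1 : ∀ {A : Set} (a? : Dec A) → indicator a? ℕ.≤ 1
  indicator≤1 (yes _) = ℕ.≤-refl
  indicator≤1 (no _)  = ℕ.z≤n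

multiples-antitone : ∀ {P Q} → + P ∣ + Q → (s : Vector ℤ d) → multiples Q s ℕ.≤ multiples P s
multiples-antitone {zero}  P∣Q s = ℕ.z≤n
multiples-antitone {suc d} {P} {Q} P∣Q s =
  ℕ.+-mono-≤ (mono (+ Q ℤ.∣? s zero) (+ P ℤ.∣? s zero)) (multiples-antitone P∣Q (s ∘ suc))
  where
  mono : (a : Dec (+ Q ∣ s zero)) (b : Dec (+ P ∣ s zero)) → indicator a ℕ.≤ indicator b
  mono (no _)  _         = ℕ.z≤n
  mono (yes _) (yes _)   = ℕ.≤-refl
  mono (yes a) (no ¬b)   = contradiction (ℤ.∣-trans P∣Q a) ¬b

sum-multiples : ∀ {P c} {F : ℤ → ℤ} → (∀ {x} → + P ∣ x → F x ≡ c) → (∀ {x} → ¬ + P ∣ x → F x ≡ 0ℤ) →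
                (s : Vector ℤ d) → ∑[ i < d ] F (s i) ≡ + multiples P s * c
sum-multiples {zero}  {P} {c} on off s = sym (*-zeroˡ c)
sum-multiples {suc d} {P} {c} {F} on off s = trans
  (cong₂ _+_ (value (+ P ℤ.∣? s zero)) (sum-multiples on off (s ∘ suc)))
  (sym (trans (cong (_* c) (pos-+ (indicator (+ P ℤ.∣? s zero)) (multiples P (s ∘ suc)))) (*-distribʳ-+ c (+ indicator (+ P ℤ.∣? s zero)) (+ multiples P (s ∘ suc)))))
  where
  value : (a : Dec (+ P ∣ s zero)) → F (s zero) ≡ + indicator a * c
  value (yes P∣s) = trans (on P∣s) (sym (*-identityˡ c))
  value (no  P∤s) = trans (off P∤s) (sym (*-zeroˡ c))

-- Balance between consecutive powers of p, and the descent

module _ {p} (pp : Prime p) (n : ℕ) {f : ℤ → ℤ} (per : Period f (+ (p ℕ.^ suc n))) where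

  private
    q P : ℕ
    q = p ℕ.^ n
    P = p ℕ.^ suc n

    instance
      p≢0 : ℕ.NonZero p
      p≢0 = ℕ.prime⇒nonZero pp
      q≢0 : ℕ.NonZero q
      q≢0 = ℕ.m^n≢0 p n

  -- It vanishes identically exactly when `q` is a period of `f`, so it measures whether the level
  -- `n + 1` is genuine.
  difference : ℤ → ℤ
  difference g = f g - f (g + + q)

  -- The orbit sum has period `e`, as `N * e` is a period of `f`, and it inherits the period `P`. It
  -- therefore has their gcd as a period, and this proper divisor of pⁿ⁺¹ divides `q`.
  orbitSum-period-q : ∀ N {e} → + P ∣ + N * e → ¬ + P ∣ e → Period (orbitSum N e f) (+ q)
  orbitSum-period-q N {e} P∣Ne P∤e = [ (λ gcd≡P → contradiction (P∣e gcd≡P) P∤e) , (λ gcd∣q → period-∣ per-gcd (ℤ.∣ᵤ⇒∣ gcd∣q)) ]′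
    (∣prime^suc pp n (ℕ.gcd[m,n]∣n ∣ e ∣ P))
    where
    per-gcd : Period (orbitSum N e f) (+ ℕ.gcd ∣ e ∣ P)
    per-gcd = period-gcd {orbitSum N e f}
      (period-∣ {orbitSum N e f} (orbitSum-step {N} {e} {f} (period-∣ {f} per P∣Ne)) ℤ.m∣∣m∣)
      (orbitSum-period {N} {e} {f} per)
    P∣e : ℕ.gcd ∣ e ∣ P ≡ P → + P ∣ e
    P∣e gcd≡P = ℤ.∣ᵤ⇒∣ (subst (ℕ._∣ ∣ e ∣) gcd≡P (ℕ.gcd[m,n]∣m ∣ e ∣ P))

  orbitSum-difference : ∀ N e g → orbitSum N e difference g ≡ orbitSum N e f g - orbitSum N e f (g + + q)
  orbitSum-difference N e g = begin
    ∑< N (λ t → f (g + + t * e) - f (g + + t * e + + q))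
      ≡⟨ ∑<-+ N (λ t → f (g + + t * e)) (λ t → - f (g + + t * e + + q)) ⟩
    orbitSum N e f g + ∑< N (λ t → - f (g + + t * e + + q))
      ≡⟨ cong (_+_ (orbitSum N e f g)) (trans (sum-neg {N} (λ t → f (g + + toℕ t * e + + q)))
           (cong -_ (∑<-cong N λ t _ → cong f (xy∙z≈xz∙y g (+ t * e) (+ q))))) ⟩
    orbitSum N e f g - orbitSum N e f (g + + q) ∎
    where
    open ≡-Reasoning

  orbitSum-difference-∤ : ∀ N {e} → + P ∣ + N * e → ¬ + P ∣ e → ∀ g → orbitSum N e difference g ≡ 0ℤ
  orbitSum-difference-∤ N {e} P∣Ne P∤e g = trans (orbitSum-difference N e g)
    (trans (cong (_-_ (orbitSum N e f g)) (orbitSum-period-q N P∣Ne P∤e g)) (+-inverseʳ (orbitSum N e f g)))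

  difference-period : Period difference (+ P)
  difference-period g = cong₂ _-_ (per g) (trans (cong f (xy∙z≈xz∙y g (+ P) (+ q))) (per (g + + q)))

  orbitSum-difference-∣ : ∀ N {e} → + P ∣ e → ∀ g → orbitSum N e difference g ≡ + N * difference g
  orbitSum-difference-∣ N {e} P∣e g =
    trans (∑<-cong N λ t _ → period-∣ {difference} difference-period (ℤ.∣n⇒∣m*n (+ t) P∣e) g) (sum-const N (difference g))

  module _ (s : Vector ℤ d) (ann : ∀ u → .{{ℕ.NonZero u}} → Coprime u p → Annihilates (scale (+ u) s) f) where

    private
      differenceSum : ℤ → ℕ → ℤ
      differenceSum g u = (scale (+ u) s ⋆ difference) g

    -- Summing over all u < P leaves only the multiples of p; both totals count
    -- shifts, since an orbit sum of the difference vanishes along a step that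
    -- generates pⁿ modulo P.
    differenceSum-coprime : ∀ g u → ¬ p ℕ.∣ u → differenceSum g u ≡ 0ℤ
    differenceSum-coprime g zero    p∤0 = contradiction (p ℕ.∣0) p∤0
    differenceSum-coprime g u@(suc _) p∤u =
      annihilates-difference {f = f} (scale (+ u) s) (+ q) (ann u (ℕ.sym (prime∤⇒coprime pp p∤u))) g

    sum-differenceSum : ∀ g → ∑< P (differenceSum g) ≡ + multiples P s * (+ P * difference g)
    sum-differenceSum g = trans (∑-comm {P} {d} (λ u i → difference (g + + toℕ u * s i)))
      (sum-multiples {c = + P * difference g} {F = λ e → orbitSum P e difference g}
        (λ P∣e → orbitSum-difference-∣ P P∣e g)
        (λ {e} P∤e → orbitSum-difference-∤ P (ℤ.∣m⇒∣m*n e ℤ.∣-refl) P∤e g) s)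

    -- For `u = t * p` a shift `x` is traversed in steps of `p * x`, and `P` divides `p * x` exactly
    -- when `q` divides `x`. Hence `q` replaces `P` in the count of shifts.
    sum-differenceSum-multiples : ∀ g → ∑< q (λ t → differenceSum g (t ℕ.* p)) ≡ + multiples q s * (+ q * difference g)
    sum-differenceSum-multiples g = trans
      (trans (∑<-cong q λ t _ → sum-cong-≗ {d} λ i → cong (λ x → difference (g + x))
               (trans (cong (_* s i) (pos-* t p)) (*-assoc (+ t) (+ p) (s i))))
             (∑-comm {q} {d} (λ t i → difference (g + + toℕ t * (+ p * s i)))))
      (sum-multiples {c = + q * difference g} {F = λ x → orbitSum q (+ p * x) difference g}
        (λ {x} q∣x → orbitSum-difference-∣ q (subst (_∣ + p * x) (sym (pos-* p q)) (ℤ.*-monoʳ-∣ (+ p) q∣x)) g)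
        (λ {x} q∤x → orbitSum-difference-∤ q
           (subst₂ _∣_ (trans (*-comm (+ q) (+ p)) (sym (pos-* p q))) refl (ℤ.*-monoʳ-∣ (+ q) (ℤ.∣m⇒∣m*n x ℤ.∣-refl)))
           (λ P∣px → q∤x (ℤ.*-cancelˡ-∣ (+ p) (subst (_∣ + p * x) (pos-* p q) P∣px))) g) s)

    difference-balance : ∀ g → + multiples P s * (+ P * difference g) ≡ + multiples q s * (+ q * difference g)
    difference-balance g = begin
      + multiples P s * (+ P * difference g) ≡⟨ sum-differenceSum g ⟨
      ∑< P (differenceSum g)                             ≡⟨ cong (λ N → ∑< N (differenceSum g)) (ℕ.*-comm p q) ⟩
      ∑< (q ℕ.* p) (differenceSum g)                     ≡⟨ ∑<-multiples p q (differenceSum-coprime g) ⟩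
      ∑< q (λ t → differenceSum g (t ℕ.* p))             ≡⟨ sum-differenceSum-multiples g ⟩
      + multiples q s * (+ q * difference g) ∎
      where open ≡-Reasoning

    -- After cancelling `q`, the balance says that the difference of the two counts annihilates
    -- every value of `difference`. So the counts agree or `difference` is zero everywhere.
    balanced⊎periodic : multiples q s ≡ p ℕ.* multiples P s ⊎ Period f (+ q)
    balanced⊎periodic with multiples q s ℕ.≟ p ℕ.* multiples P s
    ... | yes eq  = inj₁ eq
    ... | no  neq = inj₂ λ g → sym (i-j≡0⇒i≡j _ _ (difference≡0 g))
      where
      regroup : ∀ z p q y → z * (p * q * y) ≡ q * (p * z * y)
      regroup = solve-∀
      swap : ∀ a b c → a * (b * c) ≡ b * (a * c)
      swap = solve-∀
      balance : ∀ g → + (p ℕ.* multiples P s) * difference g ≡ + multiples q s * difference g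
      balance g = *-cancelˡ-≡ (+ q) _ _ (begin
        + q * (+ (p ℕ.* multiples P s) * difference g)    ≡⟨ cong (λ x → + q * (x * difference g)) (pos-* p (multiples P s)) ⟩
        + q * (+ p * + multiples P s * difference g)      ≡⟨ regroup (+ multiples P s) (+ p) (+ q) (difference g) ⟨
        + multiples P s * (+ p * + q * difference g)      ≡⟨ cong (λ x → + multiples P s * (x * difference g)) (pos-* p q) ⟨
        + multiples P s * (+ P * difference g)            ≡⟨ difference-balance g ⟩
        + multiples q s * (+ q * difference g)            ≡⟨ swap (+ multiples q s) (+ q) (difference g) ⟩
        + q * (+ multiples q s * difference g)            ∎)
        where open ≡-Reasoning
      difference≡0 : ∀ g → difference g ≡ 0ℤ
      difference≡0 g with difference g ≟ 0ℤ
      ... | yes ≡0 = ≡0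
      ... | no  ≢0 = contradiction (+-injective (*-cancelʳ-≡ _ _ (difference g) {{≢-nonZero ≢0}} (sym (balance g)))) neq

-- Each of w successive levels multiplies the number of shifts divisible by pⁿ
-- by p, because the residue r survives summation over p translates up to a
-- factor p and so keeps the function nonzero.
descent : ∀ {p} → Prime p → ∀ n w {M r f} (s : Vector ℤ d) → .{{ℕ.NonZero d}} → Period f (+ (p ℕ.^ n)) →
  (∀ u → .{{ℕ.NonZero u}} → Coprime u p → Annihilates (scale (+ u) s) f) →
  (∀ g → M ∣ f g - r) → (∀ i → i ℕ.< w → ¬ M ∣ + (p ℕ.^ i) * r) →
  p ℕ.^ w ℕ.* multiples (p ℕ.^ n) s ℕ.≤ d
descent {d = d} {p} pp n zero s per ann f≡r M∤r =
  ℕ.≤-trans (ℕ.≤-reflexive (ℕ.*-identityˡ (multiples (p ℕ.^ n) s))) (multiples≤ (p ℕ.^ n) s)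
-- At level 0 the period is 1, so `f` is constant. The nonempty family then forces this constant to
-- be 0, and the congruence yields `M ∣ r`, which is excluded at `i = 0`.
descent {d = d} {p} pp zero (suc w) {M} {r} {f} s per ann f≡r M∤r =
  contradiction (subst (M ∣_) (sym (*-identityˡ r)) M∣r) (M∤r 0 ℕ.z<s)
  where
  d*f≡0 : + d * f 0ℤ ≡ 0ℤ
  d*f≡0 = trans (sym (sum-const d (f 0ℤ)))
    (trans (sum-cong-≗ {d} λ i → sym (period-∣ {f} per (divides (1ℤ * s i) (sym (*-identityʳ (1ℤ * s i)))) 0ℤ)) (ann 1 (ℕ.1-coprimeTo p) 0ℤ))
  f0≡0 : f 0ℤ ≡ 0ℤ
  f0≡0 = *-cancelˡ-≡ (+ d) (f 0ℤ) 0ℤ (trans d*f≡0 (sym (*-zeroʳ (+ d))))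
  M∣r : M ∣ r
  M∣r = subst (M ∣_) (trans (cong (λ x → - (x - r)) f0≡0) (negate r)) (ℤ.∣m⇒∣-m (f≡r 0ℤ))
    where
    negate : ∀ r → - (0ℤ - r) ≡ r
    negate = solve-∀
descent {d = d} {p} pp (suc n) (suc w) {M} {r} {f} s per ann f≡r M∤r with balanced⊎periodic pp n {f} per s ann
... | inj₁ eq = ℕ.≤-trans (ℕ.≤-reflexive regroup)
      (descent pp n w s (orbitSum-step {p} {+ (p ℕ.^ n)} {f} (subst (Period f) (pos-* p (p ℕ.^ n)) per))
        (λ u cop → orbitSum-annihilates {N = p} {+ (p ℕ.^ n)} {f} (scale (+ u) s) (ann u cop))
        (orbitSum-≡mod {f = f} p (+ (p ℕ.^ n)) f≡r)
        (λ i i<w M∣ → M∤r (suc i) (ℕ.s<s i<w) (subst (M ∣_) (shift i) M∣)))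
  where
  regroup : p ℕ.^ suc w ℕ.* multiples (p ℕ.^ suc n) s ≡ p ℕ.^ w ℕ.* multiples (p ℕ.^ n) s
  regroup = trans (cong (ℕ._* multiples (p ℕ.^ suc n) s) (ℕ.*-comm p (p ℕ.^ w)))
    (trans (ℕ.*-assoc (p ℕ.^ w) p _) (cong (p ℕ.^ w ℕ.*_) (sym eq)))
  shift : ∀ i → + (p ℕ.^ i) * (+ p * r) ≡ + (p ℕ.^ suc i) * r
  shift i = trans (sym (*-assoc (+ (p ℕ.^ i)) (+ p) r))
    (cong (_* r) (trans (*-comm (+ (p ℕ.^ i)) (+ p)) (sym (pos-* p (p ℕ.^ i)))))
-- No factor `p` is gained here: `f` itself goes down a level with `w` unchanged, and the count can
-- only grow when the divisor shrinks.
... | inj₂ per′ = ℕ.≤-trans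
      (ℕ.*-monoʳ-≤ (p ℕ.^ suc w) (multiples-antitone (ℤ.∣ᵤ⇒∣ (ℕ.n∣m*n p)) s))
      (descent pp n (suc w) s per′ ann f≡r M∤r)

factor-out : ∀ p → .{{ℕ.NonTrivial p}} → ∀ T → .{{ℕ.NonZero T}} → ∃₂ λ a m → T ≡ p ℕ.^ a ℕ.* m × ¬ p ℕ.∣ m
factor-out p T = <-rec (λ T → .{{ℕ.NonZero T}} → ∃₂ λ a m → T ≡ p ℕ.^ a ℕ.* m × ¬ p ℕ.∣ m) go T
  where
  go : ∀ T → (∀ {T′} → T′ ℕ.< T → .{{ℕ.NonZero T′}} → ∃₂ λ a m → T′ ≡ p ℕ.^ a ℕ.* m × ¬ p ℕ.∣ m) →
       .{{ℕ.NonZero T}} → ∃₂ λ a m → T ≡ p ℕ.^ a ℕ.* m × ¬ p ℕ.∣ m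
  go T rec with p ℕ.∣? T
  ... | no  p∤T = 0 , T , sym (ℕ.*-identityˡ T) , p∤T
  ... | yes p∣T with rec (ℕ.quotient-< p∣T) {{ℕ.quotient≢0 p∣T}}
  ...   | a , m , eq , p∤m = suc a , m ,
          trans (ℕ.m∣n⇒n≡m*quotient p∣T) (trans (cong (p ℕ.*_) eq) (sym (ℕ.*-assoc p (p ℕ.^ a) m))) , p∤m

-- Periodicity from a two-sided linear recurrence

maximum : ∀ (s : Vector ℤ (suc d)) → ∃ λ i → ∀ j → s j ≤ s i
maximum {zero}  s = zero , λ { zero → ≤-refl }
maximum {suc d} s with maximum (s ∘ suc)
... | i , s≤sᵢ with ≤-total (s zero) (s (suc i))
...   | inj₁ s₀≤sᵢ = suc i , λ { zero → s₀≤sᵢ ; (suc j) → s≤sᵢ j }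
...   | inj₂ sᵢ≤s₀ = zero  , λ { zero → ≤-refl ; (suc j) → ≤-trans (s≤sᵢ j) sᵢ≤s₀ }

multiple-sum : ∀ {n y} (h : Vector ℤ n) → (∀ j → h j ≡ y ⊎ h j ≡ 0ℤ) → ∃ λ c → sum h ≡ + c * y
multiple-sum {zero}  {y} h hs = 0 , sym (*-zeroˡ y)
multiple-sum {suc n} {y} h hs with hs zero | multiple-sum (h ∘ suc) (hs ∘ suc)
... | inj₁ h₀≡y | c , eq = suc c , trans (cong₂ _+_ h₀≡y eq) (sym (suc-* (+ c) y))
... | inj₂ h₀≡0 | c , eq = c , trans (cong₂ _+_ h₀≡0 eq) (+-identityˡ (+ c * y))

-- Several shifts may attain the maximum, so the leading value of the recurrence enters with some
-- positive coefficient. That coefficient can be cancelled in the integers.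
positive-multiple-sum : ∀ {n y} (h : Vector ℤ n) → (∀ j → h j ≡ y ⊎ h j ≡ 0ℤ) →
                        ∀ i → h i ≡ y → ∃ λ c → sum h ≡ + suc c * y
positive-multiple-sum {suc n} {y} h hs zero h₀≡y with multiple-sum (h ∘ suc) (hs ∘ suc)
... | c , eq = c , trans (cong₂ _+_ h₀≡y eq) (sym (suc-* (+ c) y))
positive-multiple-sum {suc n} {y} h hs (suc i) hᵢ≡y with hs zero | positive-multiple-sum (h ∘ suc) (hs ∘ suc) i hᵢ≡y
... | inj₁ h₀≡y | c , eq = suc c , trans (cong₂ _+_ h₀≡y eq) (sym (suc-* (+ suc c) y))
... | inj₂ h₀≡0 | c , eq = c , trans (cong₂ _+_ h₀≡0 eq) (+-identityˡ (+ suc c * y))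

module _ {s : Vector ℤ d} {i k : Fin d} (s≤sᵢ : ∀ j → s j ≤ s i) (sₖ≤s : ∀ j → s k ≤ s j) {D : ℤ → ℤ} (ann : Annihilates s D) where

  private
    W : ℕ
    W = ∣ s i - s k ∣

    offset : ∀ j → + ∣ s j - s k ∣ ≡ s j - s k
    offset j = 0≤i⇒+∣i∣≡i (i≤j⇒0≤j-i (sₖ≤s j))

  -- The relation is placed with its least shift at `x`. Every term then lies in the window and is
  -- zero, or belongs to a maximal shift and equals the value at `x + W`.
  vanish-next : ∀ x → (∀ t → t ℕ.< W → D (x + + t) ≡ 0ℤ) → D (x + + W) ≡ 0ℤ
  vanish-next x window with positive-multiple-sum (λ j → D (x - s k + s j)) cases i (cong D (sym (at i)))
    where
    at : ∀ j → x + + ∣ s j - s k ∣ ≡ x - s k + s j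
    at j = trans (cong (_+_ x) (offset j)) (assoc x (s j) (s k))
      where
      assoc : ∀ x y z → x + (y - z) ≡ x - z + y
      assoc = solve-∀
    cases : ∀ j → D (x - s k + s j) ≡ D (x + + W) ⊎ D (x - s k + s j) ≡ 0ℤ
    cases j with ℕ.m≤n⇒m<n∨m≡n (drop‿+≤+ (subst₂ _≤_ (sym (offset j)) (sym (offset i)) (+-monoˡ-≤ (- s k) (s≤sᵢ j))))
    ... | inj₁ t<W = inj₂ (trans (cong D (sym (at j))) (window ∣ s j - s k ∣ t<W))
    ... | inj₂ t≡W = inj₁ (trans (cong D (sym (at j))) (cong (λ t → D (x + + t)) t≡W))
  ... | c , eq = *-cancelˡ-≡ (+ suc c) _ _ (trans (sym eq) (trans (ann (x - s k)) (sym (*-zeroʳ (+ suc c)))))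

  vanish-right : ∀ x → (∀ t → t ℕ.< W → D (x + + t) ≡ 0ℤ) → ∀ n → D (x + + n) ≡ 0ℤ
  vanish-right x window = <-rec (λ n → D (x + + n) ≡ 0ℤ) go
    where
    go : ∀ n → (∀ {m} → m ℕ.< n → D (x + + m) ≡ 0ℤ) → D (x + + n) ≡ 0ℤ
    go n rec with n ℕ.<? W
    ... | yes n<W = window n n<W
    ... | no  n≮W = trans (cong D (sym (split m+W≡n)))
        (vanish-next (x + + m) λ t t<W → trans (cong D (+-assoc x (+ m) (+ t)))
          (rec (subst (m ℕ.+ t ℕ.<_) m+W≡n (ℕ.+-monoʳ-< m t<W))))
      where
      m = n ℕ.∸ W
      m+W≡n : m ℕ.+ W ≡ n
      m+W≡n = ℕ.m∸n+n≡m (ℕ.≮⇒≥ n≮W)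
      split : ∀ {n} → m ℕ.+ W ≡ n → x + + m + + W ≡ x + + n
      split eq = trans (+-assoc x (+ m) (+ W)) (cong (λ n → x + + n) eq)

-- To the right of `x` this is `vanish-right`. The rest follows by reflection: `D (- y)` is
-- annihilated by the negated shifts, for which maximum and minimum change places.
vanish : ∀ {s : Vector ℤ d} {i k : Fin d} → (∀ j → s j ≤ s i) → (∀ j → s k ≤ s j) → ∀ {D} → Annihilates s D →
         ∀ x → (∀ t → t ℕ.< ∣ s i - s k ∣ → D (x + + t) ≡ 0ℤ) → ∀ g → D g ≡ 0ℤ
vanish {d} {s} {i} {k} s≤sᵢ sₖ≤s {D} ann x window g with ≤-total (x + + W) g
  where W = ∣ s i - s k ∣
... | inj₁ x+W≤g = trans (cong D (sym at)) (vanish-right {s = s} {i} {k} s≤sᵢ sₖ≤s {D} ann x window (W ℕ.+ ∣ g - (x + + W) ∣))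
  where
  W = ∣ s i - s k ∣
  assoc : ∀ x w g → x + (w + (g - (x + w))) ≡ g
  assoc = solve-∀
  at : x + + (W ℕ.+ ∣ g - (x + + W) ∣) ≡ g
  at = trans (cong (λ y → x + (+ W + y)) (0≤i⇒+∣i∣≡i (i≤j⇒0≤j-i x+W≤g))) (assoc x (+ W) g)
... | inj₂ g≤x+W = trans (cong D (sym at))
    (vanish-right {s = λ j → - s j} {k} {i} (λ j → neg-mono-≤ (sₖ≤s j)) (λ j → neg-mono-≤ (s≤sᵢ j)) {λ y → D (- y)}
      (λ y → trans (sum-cong-≗ {d} λ j → cong D (reflect y (s j))) (ann (- y))) (- (x + + W)) window⁻ ∣ (x + + W) - g ∣)
  where
  W = ∣ s i - s k ∣
  reflect : ∀ y z → - (y + - z) ≡ - y + z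
  reflect = solve-∀
  assoc : ∀ x g → - (- x + (x - g)) ≡ g
  assoc = solve-∀
  at : - (- (x + + W) + + ∣ (x + + W) - g ∣) ≡ g
  at = trans (cong (λ y → - (- (x + + W) + y)) (0≤i⇒+∣i∣≡i (i≤j⇒0≤j-i g≤x+W))) (assoc (x + + W) g)
  width : ∣ - s k - - s i ∣ ≡ W
  width = cong ∣_∣ (swap (s k) (s i))
    where
    swap : ∀ a b → - a - - b ≡ b - a
    swap = solve-∀
  window⁻ : ∀ t → t ℕ.< ∣ - s k - - s i ∣ → D (- (- (x + + W) + + t)) ≡ 0ℤ
  -- The reflected window consists of the points from `x + 1` to `x + W`. Its end `x + W` lies
  -- outside `window`, so the values come from `vanish-right`.
  window⁻ t t<W = trans (cong D (trans (cong (λ w → - (- (x + + w) + + t)) (sym (ℕ.m∸n+n≡m (ℕ.<⇒≤ t<W′)))) (back x (+ (W ℕ.∸ t)) (+ t))))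
    (vanish-right {s = s} {i} {k} s≤sᵢ sₖ≤s {D} ann x window (W ℕ.∸ t))
    where
    t<W′ = subst (t ℕ.<_) width t<W
    back : ∀ x u t → - (- (x + (u + t)) + t) ≡ x + u
    back = solve-∀

-- Among one more starting point than there are colour patterns of length `W`, two show the same
-- pattern. With `T` their distance, `f g - f (g + T)` is annihilated by `s` and vanishes on a whole
-- window, hence everywhere.
periodic : ∀ {k} (χ : ℤ → Fin k) (value : Fin k → ℤ) (s : Vector ℤ (suc d)) → Annihilates s (value ∘ χ) →
           ∃ λ T → ℕ.NonZero T × Period (value ∘ χ) (+ T)
periodic {d} {k} χ value s ann
  with maximum s | maximum (λ j → - s j)
... | i , s≤sᵢ | l , -s≤-sₗ
  with Fin.pigeonhole (ℕ.n<1+n (k ℕ.^ ∣ s i - s l ∣)) (λ j → Fin.funToFin (λ (t : Fin ∣ s i - s l ∣) → χ (+ toℕ j + + toℕ t)))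
... | a , b , a<b , same = T , ℕ.>-nonZero (ℕ.m<n⇒0<n∸m a<b) , λ g → sym (i-j≡0⇒i≡j _ _
      (vanish {s = s} {i} {l} s≤sᵢ (λ j → neg-cancel-≤ (-s≤-sₗ j)) {λ g → f g - f (g + + T)}
        (annihilates-difference {f = f} s (+ T) ann) (+ toℕ a) window g))
  where
  f = value ∘ χ
  W = ∣ s i - s l ∣
  T = toℕ b ℕ.∸ toℕ a
  χ-same : ∀ t → χ (+ toℕ a + + toℕ t) ≡ χ (+ toℕ b + + toℕ t)
  χ-same t = trans (sym (Fin.finToFun-funToFin {W} _ t)) (trans (cong (λ c → Fin.finToFun {k} {W} c t) same) (Fin.finToFun-funToFin {W} _ t))
  shift : ∀ {t} → + toℕ a + + t + + T ≡ + toℕ b + + t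
  shift {t} = trans (xy∙z≈xz∙y (+ toℕ a) (+ t) (+ T)) (cong (λ n → + n + + t) (ℕ.m+[n∸m]≡n (ℕ.<⇒≤ a<b)))
  window : ∀ t → t ℕ.< W → f (+ toℕ a + + t) - f (+ toℕ a + + t + + T) ≡ 0ℤ
  window t t<W = i≡j⇒i-j≡0 (trans
    (subst (λ t → f (+ toℕ a + + t) ≡ f (+ toℕ b + + t)) (Fin.toℕ-fromℕ< t<W) (cong value (χ-same (Fin.fromℕ< t<W))))
    (sym (cong f shift)))

-- Bounding the number of zero shifts

prime^∤prime^* : ∀ {p} → Prime p → ∀ {w N} → ¬ p ℕ.∣ N → ∀ i → i ℕ.< w → ¬ p ℕ.^ w ℕ.∣ p ℕ.^ i ℕ.* N
prime^∤prime^* {p} pp {w} {N} p∤N i i<w p^w∣ = p∤N (ℕ.*-cancelˡ-∣ (p ℕ.^ i) {{ℕ.m^n≢0 p i {{ℕ.prime⇒nonZero pp}}}}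
  (ℕ.∣-trans (subst (ℕ._∣ p ℕ.^ w) (ℕ.*-comm p (p ℕ.^ i))
    (ℕ.divides (p ℕ.^ (w ℕ.∸ suc i)) (trans (cong (p ℕ.^_) (sym (ℕ.m∸n+n≡m i<w))) (ℕ.^-distribˡ-+-* p (w ℕ.∸ suc i) (suc i))))) p^w∣))

coprime-^ : ∀ {p u} → Prime p → Coprime u p → ∀ n → Coprime u (p ℕ.^ n)
coprime-^ pp cop n (i∣u , i∣p^n) with ∣prime^ pp n i∣p^n
... | inj₁ i≡1 = i≡1
... | inj₂ p∣i = contradiction (cop (ℕ.∣-trans p∣i i∣u , ℕ.∣-refl)) λ { refl → ℕ.¬prime[1] pp }

-- With T = pᵃ m, summing over `m` translates by pᵃ leaves the period pᵃ and the residue -mc, which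
-- is still prime to `p`. Zero shifts are divisible by pᵃ, so the descent bounds their number.
annihilated-zeros : ∀ {p} → Prime p → ∀ w c (s : Vector ℤ (suc d)) {B T f} → Bounded B f → .{{ℕ.NonZero T}} → Period f (+ T) →
  Annihilates s f → (∀ g → + (p ℕ.^ w) ∣ f g + + c) → ¬ p ℕ.∣ c →
  p ℕ.^ w ℕ.* multiples 0 s ℕ.≤ suc d
annihilated-zeros {d} {p} pp w c s {B} {T} {f} f≤B per ann f≡-c p∤c
  with factor-out p {{ℕ.prime⇒nonTrivial pp}} T
... | a , m , T≡p^a*m , p∤m = ℕ.≤-trans
    (ℕ.*-monoʳ-≤ (p ℕ.^ w) (multiples-antitone (ℤ.∣ᵤ⇒∣ ((p ℕ.^ a) ℕ.∣0)) s))
    (descent pp a w {f = h} s h-period h-ann h≡r r-order)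
  where
  h : ℤ → ℤ
  h = orbitSum m (+ (p ℕ.^ a)) f
  h-period : Period h (+ (p ℕ.^ a))
  h-period = orbitSum-step {m} {+ (p ℕ.^ a)} {f}
    (subst (Period f) (trans (cong +_ (trans T≡p^a*m (ℕ.*-comm (p ℕ.^ a) m))) (pos-* m (p ℕ.^ a))) per)
  h-ann : ∀ u → .{{ℕ.NonZero u}} → Coprime u p → Annihilates (scale (+ u) s) h
  -- The orbit sum is bounded by `m * B`, and its period is a power of `p`. Coprimality to `p` is
  -- thus all that a multiplier needs.
  h-ann u cop = annihilates-coprime {B = m ℕ.* B} {h} {p ℕ.^ a} (λ g → ∣sum∣≤ {m} λ t → f≤B (g + + toℕ t * + (p ℕ.^ a))) h-period s
    (orbitSum-annihilates {N = m} {+ (p ℕ.^ a)} {f} s ann) u (coprime-^ pp cop a)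
  h≡r : ∀ g → + (p ℕ.^ w) ∣ h g - + m * - + c
  h≡r = orbitSum-≡mod {f = f} m (+ (p ℕ.^ a)) λ g → subst (λ x → + (p ℕ.^ w) ∣ f g + x) (sym (neg-involutive (+ c))) (f≡-c g)
  p∤mc : ¬ p ℕ.∣ m ℕ.* c
  p∤mc p∣mc = [ p∤m , p∤c ]′ (euclidsLemma m c pp p∣mc)
  r-order : ∀ i → i ℕ.< w → ¬ + (p ℕ.^ w) ∣ + (p ℕ.^ i) * (+ m * - + c)
  r-order i i<w p^w∣ = prime^∤prime^* pp p∤mc i i<w (subst (p ℕ.^ w ℕ.∣_)
    (trans (abs-* (+ (p ℕ.^ i)) (+ m * - + c)) (cong (p ℕ.^ i ℕ.*_) (trans (abs-* (+ m) (- + c)) (cong (m ℕ.*_) (∣-i∣≡∣i∣ (+ c))))))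
    (ℤ.∣⇒∣ᵤ p^w∣))

-- Perfect colourings as annihilated functions

sum-lookup-++ : ∀ {m n} {A : Set} (F : A → ℤ) (xs : Vec A m) (ys : Vec A n) →
                sum (F ∘ lookup (xs ++ ys)) ≡ sum (F ∘ lookup xs) + sum (F ∘ lookup ys)
sum-lookup-++ F []       ys = sym (+-identityˡ _)
sum-lookup-++ F (x ∷ xs) ys = trans (cong (_+_ (F x)) (sum-lookup-++ F xs ys)) (sym (+-assoc (F x) _ _))

sum-lookup-map : ∀ {n} {A B : Set} (F : B → ℤ) (φ : A → B) (xs : Vec A n) →
                 sum (F ∘ φ ∘ lookup xs) ≡ sum (F ∘ lookup (Vec.map φ xs))
sum-lookup-map F φ []       = refl
sum-lookup-map F φ (x ∷ xs) = cong (_+_ (F (φ x))) (sum-lookup-map F φ xs)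

sum-lookup-replicate : ∀ {A : Set} n (F : A → ℤ) x → sum (F ∘ lookup (Vec.replicate n x)) ≡ + n * F x
sum-lookup-replicate n F x = trans (sum-cong-≗ {n} λ i → cong F (Vec.lookup-replicate i x)) (sum-const n (F x))

multiples-replicate : ∀ P z {n} (xs : Vec ℤ n) → z ℕ.≤ multiples P (lookup (Vec.replicate z 0ℤ ++ xs))
multiples-replicate P zero    xs = ℕ.z≤n
multiples-replicate P (suc z) xs = ℕ.+-mono-≤ (one (+ P ℤ.∣? 0ℤ)) (multiples-replicate P z xs)
  where
  one : (a : Dec (+ P ∣ 0ℤ)) → 1 ℕ.≤ indicator a
  one (yes _) = ℕ.≤-refl
  one (no ¬a) = contradiction (divides 0ℤ refl) ¬a

index : Colour → Fin 2
index black = zero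
index white = suc zero

module _ (b c : ℕ) where

  -- An eigenvector, with eigenvalue 2k − b − c, of the quotient matrix.
  weight : Fin 2 → ℤ
  weight zero       = + b
  weight (suc zero) = - + c

  sum-weight : ∀ {n} {A : Set} (col : A → Colour) (us : Vec A n) →
    sum (weight ∘ index ∘ col ∘ lookup us) ≡
    + Vec.count (λ u → col u ≟ᶜ black) us * + b + + Vec.count (λ u → col u ≟ᶜ white) us * - + c
  sum-weight col [] = sym (cong₂ _+_ (*-zeroˡ (+ b)) (*-zeroˡ (- + c)))
  sum-weight col (u ∷ us) with col u
  ... | black = trans (cong (_+_ (+ b)) (sum-weight col us))
      (add (+ b) (+ Vec.count (λ u → col u ≟ᶜ black) us) (+ Vec.count (λ u → col u ≟ᶜ white) us * - + c))
    where
    add : ∀ b x y → b + (x * b + y) ≡ (1ℤ + x) * b + y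
    add = solve-∀
  ... | white = trans (cong (_+_ (- + c)) (sum-weight col us))
      (add (- + c) (+ Vec.count (λ u → col u ≟ᶜ black) us * + b) (+ Vec.count (λ u → col u ≟ᶜ white) us))
    where
    add : ∀ c x y → c + (x + y * c) ≡ x + (1ℤ + y) * c
    add = solve-∀

  -- At a black vertex the sum factors as (z + blacks - c) b, and the total count with `whites ≡ b`
  -- gives z + blacks = c. The white case is symmetric.
  weight-balance : ∀ x z blacks whites → z ℕ.+ (blacks ℕ.+ whites) ≡ b ℕ.+ c →
    (x ≡ black → whites ≡ b) → (x ≡ white → blacks ≡ c) →
    + z * weight (index x) + (+ blacks * + b + + whites * - + c) ≡ 0ℤ
  weight-balance black z blacks whites total onBlack _ with onBlack refl
  ... | refl = begin
    + z * + b + (+ blacks * + b + + b * - + c)      ≡⟨ factor (+ z) (+ blacks) (+ b) (+ c) ⟩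
    (+ (z ℕ.+ blacks) - + c) * + b                  ≡⟨ cong (λ n → (+ n - + c) * + b) z+blacks≡c ⟩
    (+ c - + c) * + b                               ≡⟨ cong (_* + b) (+-inverseʳ (+ c)) ⟩
    0ℤ ∎
    where
    open ≡-Reasoning
    factor : ∀ z x b c → z * b + (x * b + b * - c) ≡ (z + x - c) * b
    factor = solve-∀
    z+blacks≡c : z ℕ.+ blacks ≡ c
    z+blacks≡c = ℕ.+-cancelʳ-≡ b (z ℕ.+ blacks) c
      (trans (ℕ.+-assoc z blacks b) (trans total (ℕ.+-comm b c)))
  weight-balance white z blacks whites total _ onWhite with onWhite refl
  ... | refl = begin
    + z * - + c + (+ c * + b + + whites * - + c)      ≡⟨ factor (+ z) (+ whites) (+ b) (+ c) ⟩
    (+ b - + (z ℕ.+ whites)) * + c                    ≡⟨ cong (λ n → (+ b - + n) * + c) z+whites≡b ⟩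
    (+ b - + b) * + c                                 ≡⟨ cong (_* + c) (+-inverseʳ (+ b)) ⟩
    0ℤ ∎
    where
    open ≡-Reasoning
    factor : ∀ z y b c → z * - c + (c * b + y * - c) ≡ (b - (z + y)) * c
    factor = solve-∀
    z+whites≡b : z ℕ.+ whites ≡ b
    z+whites≡b = ℕ.+-cancelʳ-≡ c (z ℕ.+ whites) b (trans (ℕ.+-assoc z whites c)
      (trans (cong (z ℕ.+_) (ℕ.+-comm whites c)) total))

count-colours : ∀ {n} {A : Set} (col : A → Colour) (us : Vec A n) →
  Vec.count (λ u → col u ≟ᶜ black) us ℕ.+ Vec.count (λ u → col u ≟ᶜ white) us ≡ n
count-colours col [] = refl
count-colours col (u ∷ us) with col u
... | black = cong suc (count-colours col us)
... | white = trans (ℕ.+-suc _ _) (cong suc (count-colours col us))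

module _ {k} (ls : Vec ℕ k) where

  neighbourShifts : Vec ℤ (k ℕ.+ k)
  neighbourShifts = Vec.map +_ ls ++ Vec.map (λ l → - + l) ls

  circulantNeighbours-shifts : ∀ g → circulantNeighbours ls g ≡ Vec.map (_+_ g) neighbourShifts
  circulantNeighbours-shifts g = sym (trans (Vec.map-++ (_+_ g) (Vec.map +_ ls) (Vec.map (λ l → - + l) ls))
    (cong₂ _++_ (sym (Vec.map-∘ (_+_ g) +_ ls)) (sym (Vec.map-∘ (_+_ g) (λ l → - + l) ls))))

  perfect⇒annihilates : ∀ b c z → z ℕ.+ (k ℕ.+ k) ≡ b ℕ.+ c → ∀ col → IsPerfect (circulant ls) b c col →
    Annihilates (lookup (Vec.replicate z 0ℤ ++ neighbourShifts)) (weight b c ∘ index ∘ col)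
  perfect⇒annihilates b c z z+2k≡b+c col (onBlack , onWhite) g = begin
    sum (h ∘ (_+_ g) ∘ lookup (Vec.replicate z 0ℤ ++ neighbourShifts))
      ≡⟨ sum-lookup-++ (h ∘ (_+_ g)) (Vec.replicate z 0ℤ) neighbourShifts ⟩
    sum (h ∘ (_+_ g) ∘ lookup (Vec.replicate z 0ℤ)) + sum (h ∘ (_+_ g) ∘ lookup neighbourShifts)
      ≡⟨ cong₂ _+_ sum-zeros sum-neighbours ⟩
    + z * h g + (+ blacks * + b + + whites * - + c)
      ≡⟨ weight-balance b c (col g) z blacks whites
           (trans (cong (z ℕ.+_) (count-colours col (circulantNeighbours ls g))) z+2k≡b+c) (onBlack g) (onWhite g) ⟩
    0ℤ ∎
    where
    open ≡-Reasoning
    h : ℤ → ℤ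
    h = weight b c ∘ index ∘ col
    blacks whites : ℕ
    blacks = Vec.count (λ u → col u ≟ᶜ black) (circulantNeighbours ls g)
    whites = Vec.count (λ u → col u ≟ᶜ white) (circulantNeighbours ls g)
    sum-zeros : sum (h ∘ (_+_ g) ∘ lookup (Vec.replicate z 0ℤ)) ≡ + z * h g
    sum-zeros = trans (sum-lookup-replicate z (h ∘ (_+_ g)) 0ℤ) (cong (λ x → + z * h x) (+-identityʳ g))
    sum-neighbours : sum (h ∘ (_+_ g) ∘ lookup neighbourShifts) ≡ + blacks * + b + + whites * - + c
    sum-neighbours = trans (sum-lookup-map h (_+_ g) neighbourShifts)
      (trans (cong (λ us → sum (h ∘ lookup us)) (sym (circulantNeighbours-shifts g)))
        (sum-weight b c col (circulantNeighbours ls g)))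

  -- The family has `b + c` members, at least `suc z` of them zero, and `annihilated-zeros` limits
  -- the zeros. Writing the surplus b + c - 2k as a successor makes the family nonempty, as
  -- `periodic` requires.
  perfect-bound : ∀ {p b c z} w → Prime p → suc z ℕ.+ (k ℕ.+ k) ≡ b ℕ.+ c → p ℕ.^ w ℕ.∣ b ℕ.+ c → ¬ p ℕ.∣ c →
                  HasPerfectColouring (circulant ls) (b , c) → p ℕ.^ w ℕ.* suc z ℕ.≤ b ℕ.+ c
  perfect-bound {p} {b} {c} {z} w pp z+2k≡b+c p^w∣b+c p∤c (col , perfect) = begin
    p ℕ.^ w ℕ.* suc z          ≤⟨ ℕ.*-monoʳ-≤ (p ℕ.^ w) (multiples-replicate 0 (suc z) neighbourShifts) ⟩
    p ℕ.^ w ℕ.* multiples 0 s  ≤⟨ bound (periodic (index ∘ col) (weight b c) s ann) ⟩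
    suc z ℕ.+ (k ℕ.+ k)        ≡⟨ z+2k≡b+c ⟩
    b ℕ.+ c                    ∎
    where
    open ℕ.≤-Reasoning
    s : Vector ℤ (suc z ℕ.+ (k ℕ.+ k))
    s = lookup (Vec.replicate (suc z) 0ℤ ++ neighbourShifts)
    h : ℤ → ℤ
    h = weight b c ∘ index ∘ col
    ann : Annihilates s h
    ann = perfect⇒annihilates b c (suc z) z+2k≡b+c col perfect
    weight≤ : ∀ x → ∣ weight b c x ∣ ℕ.≤ b ℕ.+ c
    weight≤ zero       = ℕ.m≤m+n b c
    weight≤ (suc zero) = ℕ.≤-trans (ℕ.≤-reflexive (∣-i∣≡∣i∣ (+ c))) (ℕ.m≤n+m c b)
    -- The two weights differ by `b + c`, so both are -c modulo `p ^ w`.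
    weight≡-c : ∀ x → + (p ℕ.^ w) ∣ weight b c x + + c
    weight≡-c zero       = ℤ.∣ᵤ⇒∣ p^w∣b+c
    weight≡-c (suc zero) = subst (+ (p ℕ.^ w) ∣_) (sym (+-inverseˡ (+ c))) (divides 0ℤ refl)
    bound : (∃ λ T → ℕ.NonZero T × Period h (+ T)) → p ℕ.^ w ℕ.* multiples 0 s ℕ.≤ suc z ℕ.+ (k ℕ.+ k)
    bound (T , T≢0 , per) = annihilated-zeros pp w c s {f = h} (λ g → weight≤ (index (col g))) {{T≢0}} per ann
      (λ g → weight≡-c (index (col g))) p∤c

-- The arithmetic conditions are stated through their decision procedures, so for concrete numbers
-- they are discharged by evaluation.
no-perfect : ∀ {k b c z} p w (ls : Vec ℕ k) → {True (ℕ.prime? p)} → {True (suc z ℕ.+ (k ℕ.+ k) ℕ.≟ b ℕ.+ c)} →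
             {True (p ℕ.^ w ℕ.∣? b ℕ.+ c)} → {False (p ℕ.∣? c)} → {False (p ℕ.^ w ℕ.* suc z ℕ.≤? b ℕ.+ c)} →
             ¬ HasPerfectColouring (circulant ls) (b , c)
no-perfect p w ls {pp} {sz} {dv} {nd} {lt} col =
  toWitnessFalse lt (perfect-bound ls w (toWitness pp) (toWitness sz) (toWitness dv) (toWitnessFalse nd) col)

corollary1 : ((ls : Vec ℕ 2) → ¬ HasPerfectColouring (circulant ls) (4 , 3))
    × ((ls : Vec ℕ 3) →
    All (λ bc → ¬ HasPerfectColouring (circulant ls) bc)
    ((5 , 3) ∷ (5 , 4) ∷ (6 , 4) ∷ (6 , 5) ∷ []))
    × ((ls : Vec ℕ 4) →
    All (λ bc → ¬ HasPerfectColouring (circulant ls) bc)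
    ((6 , 5) ∷ (7 , 4) ∷ (8 , 3) ∷ (7 , 5) ∷ (7 , 6) ∷ (8 , 5) ∷ (8 , 6) ∷ (8 , 7) ∷ []))
corollary1 =
  -- In every entry z = b + c - 2k - 1, and `p ^ w` is the full power of a prime `p` in `b + c`.
  (λ ls → no-perfect {z = 2} 7 1 ls) ,
  (λ ls → no-perfect {z = 1} 2 3 ls ∷ no-perfect {z = 2} 3 2 ls ∷
          no-perfect {z = 3} 5 1 ls ∷ no-perfect {z = 4} 11 1 ls ∷ []) ,
  (λ ls → no-perfect {z = 2} 11 1 ls ∷ no-perfect {z = 2} 11 1 ls ∷
          -- For (7, 5) the prime 3 would only give 3 · 4 ≤ 12, which is no contradiction; the power
          -- 4 gives 16 > 12.
          no-perfect {z = 2} 11 1 ls ∷ no-perfect {z = 3} 2 2 ls ∷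
          no-perfect {z = 4} 13 1 ls ∷ no-perfect {z = 4} 13 1 ls ∷
          no-perfect {z = 5} 7 1 ls ∷ no-perfect {z = 6} 5 1 ls ∷ [])
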